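{- Let $q$ be a prime power and let $n\ge 3$ be an integer. Then \[ s_q(n,3)=(n-2)q^4(q-1)+(n-1)(n-2)q^2(q-1)^2+\binom{n}{3}(q-1)^3. \]
   Context: $\mathbb{F}_q$ is the finite field with $q$ elements. $\mathrm{U}(n,\mathbb{F}_q)$ is the $\mathbb{F}_q$-vector space of $n\times n$ upper triangular matrices over $\mathbb{F}_q$ (entries $m_{i,j}=0$ whenever $i>j$). For $M\in \mathrm{U}(n,\mathbb{F}_q)$ and $1\le i\le n$, $M_{[i]}$ is the $i\times(n-i+1)$ submatrix of $M$ obtained by deleting the first $i-1$ columns and the last $n-i$ rows (i.e. rows $1,\dots,i$ and columns $i,\dots,n$). The flag-rank weight of $M$ is $\mathrm{fr}(M)=\sum_{i=1}^{n}\mathrm{rk}(M_{[i]})$. The number $s_q(n,t)$ is the size of the flag-rank sphere of radius $t$: $s_q(n,t)=|\{A\in \mathrm{U}(n,\mathbb{F}_q):\mathrm{fr}(A)=t\}|$. -}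

module Defs where

open import Level using (Level; _⊔_)
open import Algebra.Apartness.Bundles using (HeytingCommutativeRing; HeytingField)
open import Algebra.Bundles using (CommutativeRing)
import Algebra.Properties.CommutativeMonoid.Sum as FieldSum
import Algebra.Properties.Monoid.Sum as MonoidSum
open import Data.Fin.Base as Fin using (Fin; toℕ; inject≤; cast; _↑ʳ_)
open import Data.Fin.Properties using (toℕ<n; toℕ≤n)
open import Data.Nat.Base using (ℕ; suc; _+_; _∸_; _^_; _≤_)
open import Data.Nat.Primality using (Prime)
open import Data.Nat.Properties using (+-0-monoid; m+[n∸m]≡n)
open import Data.Product.Base using (Σ; ∃; _×_; proj₁)
open import Data.Vec.Functional using (Vector)
import Data.Vec.Functional.Relation.Binary.Equality.Setoid as VecEq
open import Function.Bundles using (Inverse)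
open import Relation.Binary.Bundles using (Setoid)
import Relation.Binary.Construct.On as On
open import Relation.Binary.PropositionalEquality.Core using (_≡_)
import Relation.Binary.PropositionalEquality.Properties as ≡

private
  variable
    a ℓ : Level

HasCardinality : Setoid a ℓ → ℕ → Set (a ⊔ ℓ)
HasCardinality S k = Inverse S (≡.setoid (Fin k))

IsPrimePower : ℕ → Set
IsPrimePower q = ∃ λ p → ∃ λ k → Prime p × 1 ≤ k × q ≡ p ^ k

-- On a finite carrier, a Heyting field is the same thing as a field in the
-- classical sense: tightness together with the decidability of invertibility
-- makes x # y equivalent to ¬ (x ≈ y).  In particular ¬ (0# ≈ 1#), since
-- 1# - 0# is invertible, hence 1# # 0#.
module FlagRank {c ℓ₁ ℓ₂} (F : HeytingField c ℓ₁ ℓ₂) where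

  open HeytingField F using (Carrier; _≈_; _*_; 0#; heytingCommutativeRing)
  open HeytingCommutativeRing heytingCommutativeRing using (commutativeRing)
  open CommutativeRing commutativeRing using (+-commutativeMonoid) renaming (setoid to fieldSetoid)
  open FieldSum +-commutativeMonoid using (sum)
  open MonoidSum +-0-monoid using () renaming (sum to sumℕ)

  HasOrder : ℕ → Set (c ⊔ ℓ₁)
  HasOrder q = HasCardinality fieldSetoid q

  -- M i j is the entry in row i and column j; indices are counted from 0.
  Matrix : ℕ → ℕ → Set c
  Matrix m n = Vector (Vector Carrier n) m

  matrixSetoid : ℕ → ℕ → Setoid c ℓ₁
  matrixSetoid m n = VecEq.≋-setoid (VecEq.≋-setoid fieldSetoid n) m

  UpperTriangular : ∀ {n} → Matrix n n → Set ℓ₁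
  UpperTriangular M = ∀ i j → j Fin.< i → M i j ≈ 0#

  LinearlyIndependent : ∀ {m r} → (Fin r → Vector Carrier m) → Set (c ⊔ ℓ₁)
  LinearlyIndependent {m} {r} v =
    (α : Vector Carrier r) → (∀ i → sum (λ k → α k * v k i) ≈ 0#) → ∀ k → α k ≈ 0#

  column : ∀ {m n} → Matrix m n → Fin n → Vector Carrier m
  column M j i = M i j

  -- A selection σ of linearly independent columns is
  -- automatically injective, because 0# and 1# are distinct.
  IndependentColumns : ∀ {m n} → Matrix m n → ℕ → Set (c ⊔ ℓ₁)
  IndependentColumns {n = n} M r =
    Σ (Fin r → Fin n) λ σ → LinearlyIndependent (λ k → column M (σ k))

  -- "rk(M) = r", where the rank is the maximal number of linearly independent
  -- columns.  As a maximum, r is determined by M.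
  HasRank : ∀ {m n} → Matrix m n → ℕ → Set (c ⊔ ℓ₁)
  HasRank M r = IndependentColumns M r × (∀ s → IndependentColumns M s → s ≤ r)

  -- Rows 0, …, i and columns i, …, n - 1.  As i is counted from 0, this is the
  -- submatrix M_[i+1], of size (i + 1) × (n - i).
  corner : ∀ {n} → Matrix n n → (i : Fin n) → Matrix (suc (toℕ i)) (n ∸ toℕ i)
  corner M i a b =
    M (inject≤ a (toℕ<n i)) (cast (m+[n∸m]≡n (toℕ≤n i)) (toℕ i ↑ʳ b))

  -- "fr(M) = t".
  HasFlagRank : ∀ {n} → Matrix n n → ℕ → Set (c ⊔ ℓ₁)
  HasFlagRank {n} M t =
    Σ (Vector ℕ n) λ r → (∀ i → HasRank (corner M i) (r i)) × sumℕ r ≡ t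

  -- Two elements are identified when their matrices agree entrywise, so the
  -- cardinality of this setoid counts matrices and is s_q(n,t).
  sphere : ℕ → ℕ → Setoid (c ⊔ ℓ₁) ℓ₁
  sphere n t = On.setoid (matrixSetoid n n) matrix
    where
    matrix : (Σ (Matrix n n) λ M → UpperTriangular M × HasFlagRank M t) → Matrix n n
    matrix = proj₁

{-# OPTIONS --safe #-}
module Submission where

-- If fr(M) ≤ 3, then every 2 × 2 minor of every corner of M vanishes, because a
-- nonzero one would force corner ranks 1, 2, 1 at three different positions.
-- Hence every corner has rank at most 1 and fr(M) counts the nonzero corners.
-- Such an M is block diagonal: the last nonzero entry of the first row lies in
-- one of the first three columns, and the vanishing minors clear
-- everything to the right of the block that it spans.  A block of size k with
-- nonzero top right entry has weight k, and there are p, p q², p q⁴ of them for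
-- k = 1, 2, 3 with p = q − 1, so that s(n,t) = s(n−1,t) + p s(n−1,t−1)
-- + p q² s(n−2,t−2) + p q⁴ s(n−3,t−3) for t ≤ 3.

open import Defs
open import Algebra.Apartness.Bundles using (HeytingField; HeytingCommutativeRing)
open import Algebra.Bundles using (CommutativeRing)
import Algebra.Properties.CommutativeMonoid.Sum as FieldSum
import Algebra.Properties.Monoid.Sum as MonoidSum
import Algebra.Properties.Ring as RingProperties
open import Data.Fin.Base as Fin using (Fin; zero; suc; toℕ; inject≤; cast; _↑ʳ_; fromℕ<; punchIn; punchOut)
open import Data.Fin.Properties as Finₚ using (any?; toℕ<n; toℕ≤n; toℕ-injective; toℕ-inject≤; toℕ-cast; toℕ-↑ʳ; toℕ-fromℕ<; ¬∀⟶∃¬; punchInᵢ≢i; punchIn-injective; punchIn-punchOut; *↔×; +↔⊎)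
open import Data.Nat.Base using (ℕ; zero; suc; _+_; _*_; _∸_; _^_; _≤_; z≤n; s≤s; s≤s⁻¹)
open import Data.Nat.Combinatorics using (_C_; nC1≡n; nCk+nC[k+1]≡[n+1]C[k+1])
import Data.Nat.Properties as ℕₚ
open import Data.Nat.Solver using (module +-*-Solver)
open import Data.Product.Base using (Σ; ∃; _×_; _,_; proj₁; proj₂)
open import Data.Product.Function.NonDependent.Propositional using (_×-↔_)
open import Data.Sum.Base using (_⊎_; inj₁; inj₂)
open import Data.Sum.Function.Propositional using (_⊎-↔_)
open import Data.Vec.Functional using (Vector; []; _∷_; tail)
open import Level using (_⊔_)
open import Function.Base using (_∘_)
open import Function.Bundles using (Inverse; _↔_; mk↔ₛ′)
open import Function.Construct.Composition using (_↔-∘_; inverse)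
open import Function.Construct.Identity using (↔-id)
open import Function.Construct.Symmetry using (↔-sym)
open import Relation.Binary.Definitions using (tri<; tri≈; tri>)
open import Relation.Binary.PropositionalEquality as ≡ using (_≡_; _≢_)
open import Relation.Nullary.Decidable.Core using (Dec; yes; no; map′; decidable-stable)
open import Relation.Nullary.Negation.Core using (¬_; contradiction)

open +-*-Solver using (solve; con; _:=_; _:+_; _:*_; _:^_)

-- The diagonal blocks of a thin matrix: a zero, a nonzero entry, and upper
-- triangular blocks of size 2 and 3 with a nonzero top right entry.  The first
-- argument of the last three constructors encodes that nonzero entry.
data Code (p : ℕ) : ℕ → ℕ → Set where
  empty    : Code p 0 0
  blank    : ∀ {n t} → Code p n t → Code p (1 + n) t
  single   : ∀ {n t} → Fin p → Code p n t → Code p (1 + n) (1 + t)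
  domino   : ∀ {n t} → Fin p → (a b : Fin (suc p)) → Code p n t → Code p (2 + n) (2 + t)
  triangle : ∀ {n t} → Fin p → (a b c d : Fin (suc p)) → Code p n t → Code p (3 + n) (3 + t)

-- Counting codes

module Counting (p : ℕ) where

  q : ℕ
  q = suc p

  -- `Peeled k n t` stands for `Code p (n ∸ k) (t ∸ k)`, but is empty when `n` or `t` is below `k`,
  -- where truncated subtraction would give wrong codes. It holds what follows a first block of size
  -- `k + 1`.
  data Peeled : ℕ → ℕ → ℕ → Set where
    done : ∀ {n t} → Code p n t → Peeled 0 n t
    peel : ∀ {k n t} → Peeled k n t → Peeled (suc k) (suc n) (suc t)

  -- The recursion splits off the first block. Its products are bracketed like the tuples in
  -- `FirstBlock`, so that `code↔Fin` needs no arithmetic.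
  codeCount : ℕ → ℕ → ℕ
  peeledCount : ℕ → ℕ → ℕ → ℕ

  codeCount zero    zero    = 1
  codeCount zero    (suc t) = 0
  codeCount (suc n) zero    = codeCount n zero
  codeCount (suc n) (suc t) =
    codeCount n (suc t) + (p * codeCount n t +
      (p * (q * q) * peeledCount 1 n t + p * (q * (q * (q * q))) * peeledCount 2 n t))

  peeledCount zero    n       t       = codeCount n t
  peeledCount (suc k) zero    t       = 0
  peeledCount (suc k) (suc n) zero    = 0
  peeledCount (suc k) (suc n) (suc t) = peeledCount k n t

  FirstBlock : ℕ → ℕ → Set
  FirstBlock n t =
    Code p n (suc t) ⊎ (Fin p × Code p n t) ⊎
    ((Fin p × Fin q × Fin q) × Peeled 1 n t) ⊎
    ((Fin p × Fin q × Fin q × Fin q × Fin q) × Peeled 2 n t)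

  code↔firstBlock : ∀ n t → Code p (suc n) (suc t) ↔ FirstBlock n t
  code↔firstBlock n t = mk↔ₛ′ split join
    (λ { (inj₁ _) → ≡.refl ; (inj₂ (inj₁ _)) → ≡.refl
       ; (inj₂ (inj₂ (inj₁ (_ , peel (done _))))) → ≡.refl
       ; (inj₂ (inj₂ (inj₂ (_ , peel (peel (done _)))))) → ≡.refl })
    (λ { (blank _) → ≡.refl ; (single _ _) → ≡.refl ; (domino _ _ _ _) → ≡.refl
       ; (triangle _ _ _ _ _ _) → ≡.refl })
    where
    split : ∀ {n t} → Code p (suc n) (suc t) → FirstBlock n t
    split (blank w)              = inj₁ w
    split (single x w)           = inj₂ (inj₁ (x , w))
    split (domino x a b w)       = inj₂ (inj₂ (inj₁ ((x , a , b) , peel (done w))))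
    split (triangle x a b c d w) = inj₂ (inj₂ (inj₂ ((x , a , b , c , d) , peel (peel (done w)))))

    join : ∀ {n t} → FirstBlock n t → Code p (suc n) (suc t)
    join (inj₁ w)                                                           = blank w
    join (inj₂ (inj₁ (x , w)))                                              = single x w
    join (inj₂ (inj₂ (inj₁ ((x , a , b) , peel (done w)))))                 = domino x a b w
    join (inj₂ (inj₂ (inj₂ ((x , a , b , c , d) , peel (peel (done w)))))) = triangle x a b c d w

  infixr 1 _⊎-Fin_
  _⊎-Fin_ : ∀ {A B : Set} {m n} → A ↔ Fin m → B ↔ Fin n → (A ⊎ B) ↔ Fin (m + n)
  f ⊎-Fin g = ↔-sym +↔⊎ ↔-∘ (f ⊎-↔ g)

  infixr 2 _×-Fin_
  _×-Fin_ : ∀ {A B : Set} {m n} → A ↔ Fin m → B ↔ Fin n → (A × B) ↔ Fin (m * n)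
  f ×-Fin g = ↔-sym *↔× ↔-∘ (f ×-↔ g)

  code↔Fin : ∀ n t → Code p n t ↔ Fin (codeCount n t)
  peeled↔Fin : ∀ k n t → Peeled k n t ↔ Fin (peeledCount k n t)

  code↔Fin zero    zero    = mk↔ₛ′ (λ _ → zero) (λ _ → empty) (λ { zero → ≡.refl }) (λ { empty → ≡.refl })
  code↔Fin zero    (suc t) = mk↔ₛ′ (λ ()) (λ ()) (λ ()) (λ ())
  code↔Fin (suc n) zero    = code↔Fin n zero ↔-∘
    mk↔ₛ′ (λ { (blank w) → w }) blank (λ _ → ≡.refl) (λ { (blank _) → ≡.refl })
  code↔Fin (suc n) (suc t) = (code↔Fin n (suc t) ⊎-Fin
    (↔-id _ ×-Fin code↔Fin n t) ⊎-Fin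
    ((↔-id _ ×-Fin ↔-id _ ×-Fin ↔-id _) ×-Fin peeled↔Fin 1 n t) ⊎-Fin
    ((↔-id _ ×-Fin ↔-id _ ×-Fin ↔-id _ ×-Fin ↔-id _ ×-Fin ↔-id _) ×-Fin peeled↔Fin 2 n t))
    ↔-∘ code↔firstBlock n t

  peeled↔Fin zero    n       t       = code↔Fin n t ↔-∘
    mk↔ₛ′ (λ { (done w) → w }) done (λ _ → ≡.refl) (λ { (done _) → ≡.refl })
  peeled↔Fin (suc k) zero    t       = mk↔ₛ′ (λ ()) (λ ()) (λ ()) (λ ())
  peeled↔Fin (suc k) (suc n) zero    = mk↔ₛ′ (λ ()) (λ ()) (λ ()) (λ ())
  peeled↔Fin (suc k) (suc n) (suc t) = peeled↔Fin k n t ↔-∘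
    mk↔ₛ′ (λ { (peel w) → w }) peel (λ _ → ≡.refl) (λ { (peel _) → ≡.refl })

  codeCount-0 : ∀ n → codeCount n 0 ≡ 1
  codeCount-0 zero    = ≡.refl
  codeCount-0 (suc n) = codeCount-0 n

  peeledCount-0 : ∀ k n → peeledCount (suc k) n 0 ≡ 0
  peeledCount-0 k zero    = ≡.refl
  peeledCount-0 k (suc n) = ≡.refl

  peeledCount-1 : ∀ n → peeledCount 2 n 1 ≡ 0
  peeledCount-1 zero    = ≡.refl
  peeledCount-1 (suc n) = peeledCount-0 0 n

  codeCount-1 : ∀ n → codeCount n 1 ≡ n * p
  codeCount-1 zero    = ≡.refl
  codeCount-1 (suc n)
    rewrite codeCount-1 n | codeCount-0 n | peeledCount-0 0 n | peeledCount-0 1 n = solve 3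
      (λ n p q → n :* p :+ (p :* con 1 :+ (p :* (q :* q) :* con 0 :+ p :* (q :* (q :* (q :* q))) :* con 0))
        := p :+ n :* p) ≡.refl n p q

  -- The first term counts one domino among `n` blocks, the second two singles among `suc n`. The
  -- induction step is Pascal's rule.
  codeCount-2 : ∀ n → codeCount (suc n) 2 ≡ n * q ^ 2 * p + (suc n C 2) * p ^ 2
  codeCount-2 zero    = solve 2
      (λ p q → con 0 :+ (p :* con 0 :+ (p :* (q :* q) :* con 0 :+ p :* (q :* (q :* (q :* q))) :* con 0))
        := con 0) ≡.refl p q
  codeCount-2 (suc n)
    rewrite codeCount-2 n | codeCount-1 (suc n) | codeCount-0 n | peeledCount-0 0 n
          | ≡.sym (nCk+nC[k+1]≡[n+1]C[k+1] (suc n) 1) | nC1≡n (suc n) = solve 4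
      (λ n p q b → (n :* q :^ 2 :* p :+ b :* p :^ 2) :+ (p :* ((con 1 :+ n) :* p) :+
          (p :* (q :* q) :* con 1 :+ p :* (q :* (q :* (q :* q))) :* con 0))
        := (con 1 :+ n) :* q :^ 2 :* p :+ ((con 1 :+ n) :+ b) :* p :^ 2) ≡.refl n p q (suc n C 2)

  -- The terms count the codes with one triangle among `n` blocks, with a domino and a single in
  -- either order among `1 + n` blocks, and with three singles among `2 + n` blocks.
  codeCount-3 : ∀ n → codeCount (2 + n) 3 ≡
                n * q ^ 4 * p + (1 + n) * n * q ^ 2 * p ^ 2 + ((2 + n) C 3) * p ^ 3
  codeCount-3 zero
    rewrite ℕₚ.*-zeroʳ (p * (q * q)) | ℕₚ.*-zeroʳ (p * (q * (q * (q * q)))) | ℕₚ.*-zeroʳ p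
          | ℕₚ.*-zeroʳ p = ≡.refl
  codeCount-3 (suc n)
    rewrite codeCount-3 n | codeCount-2 (suc n) | codeCount-1 (suc n) | codeCount-0 n
          | ≡.sym (nCk+nC[k+1]≡[n+1]C[k+1] (2 + n) 2) = solve 5
      (λ n p q b c →
          (n :* q :^ 4 :* p :+ (con 1 :+ n) :* n :* q :^ 2 :* p :^ 2 :+ c :* p :^ 3) :+
          (p :* ((con 1 :+ n) :* q :^ 2 :* p :+ b :* p :^ 2) :+
            (p :* (q :* q) :* ((con 1 :+ n) :* p) :+ p :* (q :* (q :* (q :* q))) :* con 1))
        := (con 1 :+ n) :* q :^ 4 :* p :+ (con 2 :+ n) :* (con 1 :+ n) :* q :^ 2 :* p :^ 2
           :+ (b :+ c) :* p :^ 3)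
      ≡.refl n p q ((2 + n) C 2) ((2 + n) C 3)

module Spheres {c ℓ₁ ℓ₂} (F : HeytingField c ℓ₁ ℓ₂) (p : ℕ) (order : FlagRank.HasOrder F (suc p)) where

  open FlagRank F
  open HeytingField F using (heytingCommutativeRing; _#_; tight; #⇒invertible)
  open HeytingCommutativeRing heytingCommutativeRing using (commutativeRing)
  open CommutativeRing commutativeRing
    renaming (_+_ to _⊕_; _*_ to _·_; -_ to ⊖_) hiding (zero)
  open RingProperties ring using (-0#≈0#; -‿distribˡ-*; +-inverseˡ-unique)
  open FieldSum +-commutativeMonoid using (sum)
  open MonoidSum ℕₚ.+-0-monoid using () renaming (sum to sumℕ)
  open import Relation.Binary.Reasoning.Setoid setoid

  -- Arithmetic of the finite field

  open Inverse order using () renaming (to to index; from to label; to-cong to index-cong)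

  label-index : ∀ x → label (index x) ≈ x
  label-index = Inverse.strictlyInverseʳ order

  index-label : ∀ k → index (label k) ≡ k
  index-label = Inverse.strictlyInverseˡ order

  label-injective : ∀ {j k} → label j ≈ label k → j ≡ k
  label-injective {j} {k} e =
    ≡.trans (≡.sym (index-label j)) (≡.trans (index-cong e) (index-label k))

  infix 4 _≟_
  _≟_ : ∀ x y → Dec (x ≈ y)
  x ≟ y = map′ (λ e → trans (sym (label-index x)) (trans (reflexive (≡.cong label e)) (label-index y)))
               index-cong (index x Finₚ.≟ index y)

  -- Apartness from zero does not follow constructively from `x ≉ 0#`, so an inverse is searched for
  -- among the finitely many labels. If none is found, `x` cannot be apart from zero, and tightness
  -- makes it zero.
  invertible : ∀ {x} → x ≉ 0# → ∃ λ y → x · y ≈ 1#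
  invertible {x} x≉0 with any? (λ k → x · label k ≟ 1#)
  ... | yes (k , e) = label k , e
  ... | no none     = contradiction (proj₁ (tight x 0#) ¬x#0) x≉0
    where
    ¬x#0 : ¬ (x # 0#)
    ¬x#0 x#0 with #⇒invertible x#0
    ... | y , _ , e = none (index y , (begin
      x · label (index y)  ≈⟨ *-congˡ (label-index y) ⟩
      x · y                ≈⟨ *-congʳ (trans (+-congˡ -0#≈0#) (+-identityʳ x)) ⟨
      (x - 0#) · y         ≈⟨ e ⟩
      1#                   ∎))

  ·-cancelˡ : ∀ {x y z} → x ≉ 0# → x · y ≈ x · z → y ≈ z
  ·-cancelˡ {x} {y} {z} x≉0 e with invertible x≉0
  ... | w , xw≈1 = trans (sym (unscale y)) (trans (*-congˡ e) (unscale z))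
    where
    unscale : ∀ u → w · (x · u) ≈ u
    unscale u = begin
      w · (x · u)  ≈⟨ *-assoc w x u ⟨
      (w · x) · u  ≈⟨ *-congʳ (trans (*-comm w x) xw≈1) ⟩
      1# · u       ≈⟨ *-identityˡ u ⟩
      u            ∎

  ·-zero-cancelˡ : ∀ {x y} → x ≉ 0# → x · y ≈ 0# → y ≈ 0#
  ·-zero-cancelˡ {x} x≉0 e = ·-cancelˡ x≉0 (trans e (sym (zeroʳ x)))

  -- If `1# ≈ 0#`, then `0# - 0#` has the inverse `0#`, which puts `0#` apart from itself.
  1≉0 : 1# ≉ 0#
  1≉0 1≈0 = proj₂ (tight 0# 0#) refl (HeytingField.invertible⇒# F
    (0# , trans (zeroˡ _) (sym 1≈0) , trans (zeroʳ _) (sym 1≈0)))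

  unit : Fin p → Carrier
  unit k = label (punchIn (index 0#) k)

  unit≉0 : ∀ k → unit k ≉ 0#
  unit≉0 k e = punchInᵢ≢i (index 0#) k (≡.trans (≡.sym (index-label _)) (index-cong e))

  unit-injective : ∀ {j k} → unit j ≈ unit k → j ≡ k
  unit-injective {j} {k} e = punchIn-injective (index 0#) j k (label-injective e)

  unit-surjective : ∀ {x} → x ≉ 0# → ∃ λ k → unit k ≈ x
  unit-surjective {x} x≉0 = punchOut 0≢x ,
    trans (reflexive (≡.cong label (punchIn-punchOut 0≢x))) (label-index x)
    where
    0≢x : index 0# ≢ index x
    0≢x e = x≉0 (trans (sym (label-index x)) (trans (reflexive (≡.cong label (≡.sym e))) (label-index 0#)))

  -- Rank of small matrices

  sum-zero : ∀ {n} (f : Vector Carrier n) → (∀ k → f k ≈ 0#) → sum f ≈ 0#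
  sum-zero {zero}  f f≈0 = refl
  sum-zero {suc n} f f≈0 = trans (+-cong (f≈0 zero) (sum-zero (tail f) (f≈0 ∘ suc))) (+-identityʳ 0#)

  0ᵛ : ∀ {n} → Vector Carrier n
  0ᵛ _ = 0#

  -- Eliminating `y` from the two equations gives `x · (a · d) ≈ x · (b · c)`, and a nonzero `x`
  -- could be cancelled.
  cramer : ∀ {x y a b c d} → a · d ≉ b · c →
           x · a ⊕ y · b ≈ 0# → x · c ⊕ y · d ≈ 0# → x ≈ 0#
  cramer {x} {y} {a} {b} {c} {d} ad≉bc xa+yb≈0 xc+yd≈0 =
    decidable-stable (x ≟ 0#) λ x≉0 → ad≉bc (·-cancelˡ x≉0 (begin
      x · (a · d)      ≈⟨ *-assoc x a d ⟨
      (x · a) · d      ≈⟨ *-congʳ (+-inverseˡ-unique _ _ xa+yb≈0) ⟩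
      (⊖ (y · b)) · d  ≈⟨ -‿distribˡ-* (y · b) d ⟨
      ⊖ ((y · b) · d)  ≈⟨ -‿cong (trans (*-assoc y b d) (trans (*-congˡ (*-comm b d)) (sym (*-assoc y d b)))) ⟩
      ⊖ ((y · d) · b)  ≈⟨ -‿distribˡ-* (y · d) b ⟩
      (⊖ (y · d)) · b  ≈⟨ *-congʳ (+-inverseˡ-unique _ _ xc+yd≈0) ⟨
      (x · c) · b      ≈⟨ *-assoc x c b ⟩
      x · (c · b)      ≈⟨ *-congˡ (*-comm c b) ⟩
      x · (b · c)      ∎))

  module _ {m n} (N : Matrix m n) where

    independent-none : IndependentColumns N 0
    independent-none = (λ ()) , λ _ _ ()

    independent-one : ∀ {x u} → N x u ≉ 0# → IndependentColumns N 1
    independent-one {x} {u} Nxu≉0 = (λ _ → u) , λ where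
      α αN≈0 zero → ·-zero-cancelˡ Nxu≉0
        (trans (*-comm (N x u) (α zero)) (trans (sym (+-identityʳ _)) (αN≈0 x)))

    independent-two : ∀ {x y u v} → N x u · N y v ≉ N x v · N y u → IndependentColumns N 2
    independent-two {x} {y} {u} {v} minor≉0 = (u ∷ v ∷ []) , λ α αN≈0 →
      let eq : ∀ w → α zero · N w u ⊕ α (suc zero) · N w v ≈ 0#
          eq w = trans (+-congˡ (sym (+-identityʳ _))) (αN≈0 w)
          -- Exchanging the two columns swaps the sides of the minor, so `cramer` also yields the
          -- second coefficient.
          eq′ : ∀ w → α (suc zero) · N w v ⊕ α zero · N w u ≈ 0#
          eq′ w = trans (+-comm _ _) (eq w)
      in λ where
        zero       → cramer minor≉0 (eq x) (eq y)
        (suc zero) → cramer (minor≉0 ∘ sym) (eq′ x) (eq′ y)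

    zero⇒rank≤0 : (∀ x u → N x u ≈ 0#) → ∀ s → IndependentColumns N s → s ≤ 0
    zero⇒rank≤0 N≈0 zero    _         = z≤n
    zero⇒rank≤0 N≈0 (suc s) (σ , ind) = contradiction
      (ind (λ _ → 1#) (λ x → sum-zero {suc s} _ λ k → trans (*-congˡ (N≈0 x (σ k))) (zeroʳ 1#)) zero) 1≉0

    -- Among two or more independent columns, the vanishing minors give linear relations between the
    -- first two. Independence then makes the first column zero, but a zero column satisfies a
    -- relation with coefficient `1#`.
    minors-zero⇒rank≤1 : (∀ x y u v → N x u · N y v ≈ N x v · N y u) →
                         ∀ s → IndependentColumns N s → s ≤ 1
    minors-zero⇒rank≤1 minors zero          _         = z≤n
    minors-zero⇒rank≤1 minors (suc zero)    _         = s≤s z≤n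
    minors-zero⇒rank≤1 minors (suc (suc s)) (σ , ind) = contradiction 1≈0 1≉0
      where
      u v : Fin n
      u = σ zero
      v = σ (suc zero)

      -- Row x of N supplies the relation N x u · column v ≈ N x v · column u.
      Nxu≈0 : ∀ x → N x u ≈ 0#
      Nxu≈0 x = ind ((⊖ N x v) ∷ N x u ∷ 0ᵛ) relation (suc zero)
        where
        relation : ∀ y → sum (λ k → ((⊖ N x v) ∷ N x u ∷ 0ᵛ) k · N y (σ k)) ≈ 0#
        relation y = begin
          (⊖ N x v) · N y u ⊕ (N x u · N y v ⊕ sum (λ k → 0# · N y (σ (suc (suc k)))))
            ≈⟨ +-cong (sym (-‿distribˡ-* _ _)) (trans (+-congˡ (sum-zero {s} _ λ k → zeroˡ _)) (+-identityʳ _)) ⟩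
          ⊖ (N x v · N y u) ⊕ N x u · N y v  ≈⟨ +-congˡ (minors x y u v) ⟩
          ⊖ (N x v · N y u) ⊕ N x v · N y u  ≈⟨ -‿inverseˡ _ ⟩
          0#                                 ∎

      1≈0 : 1# ≈ 0#
      1≈0 = ind (1# ∷ 0ᵛ) (λ y → sum-zero (λ k → (1# ∷ 0ᵛ) k · N y (σ k)) λ where
        zero    → trans (*-congˡ (Nxu≈0 y)) (zeroʳ 1#)
        (suc k) → zeroˡ _) zero

  -- Corners

  module _ {n} (M : Matrix n n) where

    -- `cornerRow` and `cornerColumn` are the index maps inside `corner`, so `corner M i a b` is
    -- definitionally `M (cornerRow i a) (cornerColumn i b)`.
    cornerRow : (i : Fin n) → Fin (suc (toℕ i)) → Fin n
    cornerRow i a = inject≤ a (toℕ<n i)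

    cornerColumn : (i : Fin n) → Fin (n ∸ toℕ i) → Fin n
    cornerColumn i b = cast (ℕₚ.m+[n∸m]≡n (toℕ≤n i)) (toℕ i ↑ʳ b)

    cornerRow≤ : ∀ i a → cornerRow i a Fin.≤ i
    cornerRow≤ i a = ≡.subst (_≤ toℕ i) (≡.sym (toℕ-inject≤ a _)) (s≤s⁻¹ (toℕ<n a))

    toℕ-cornerColumn : ∀ i b → toℕ (cornerColumn i b) ≡ toℕ i + toℕ b
    toℕ-cornerColumn i b = ≡.trans (toℕ-cast _ (toℕ i ↑ʳ b)) (toℕ-↑ʳ (toℕ i) b)

    ≤cornerColumn : ∀ i b → i Fin.≤ cornerColumn i b
    ≤cornerColumn i b = ≡.subst (toℕ i ≤_) (≡.sym (toℕ-cornerColumn i b)) (ℕₚ.m≤m+n _ _)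

    cornerRow-surjective : ∀ {i a} → a Fin.≤ i → ∃ λ x → cornerRow i x ≡ a
    cornerRow-surjective a≤i = fromℕ< (s≤s a≤i) ,
      toℕ-injective (≡.trans (toℕ-inject≤ _ _) (toℕ-fromℕ< _))

    cornerColumn-surjective : ∀ {i b} → i Fin.≤ b → ∃ λ u → cornerColumn i u ≡ b
    cornerColumn-surjective {i} {b} i≤b = fromℕ< (ℕₚ.∸-monoˡ-< (toℕ<n b) i≤b) ,
      toℕ-injective (≡.trans (toℕ-cornerColumn i _)
        (≡.trans (≡.cong (toℕ i +_) (toℕ-fromℕ< _)) (ℕₚ.m+[n∸m]≡n i≤b)))

    Blank : Fin n → Set ℓ₁
    Blank i = ∀ a b → a Fin.≤ i → i Fin.≤ b → M a b ≈ 0#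

    -- For a thin matrix this is the rank of the corner at `i`, expressed through indices of `M`
    -- itself and thus free of casts.
    data Profile (i : Fin n) : ℕ → Set ℓ₁ where
      blank   : Blank i → Profile i 0
      covered : ∀ a b → a Fin.≤ i → i Fin.≤ b → M a b ≉ 0# → Profile i 1

    -- The condition `b ≤ c` says that the minor lies in some corner, for instance the one at `b`.
    Thin : Set ℓ₁
    Thin = ∀ a b c d → a Fin.< b → b Fin.≤ c → c Fin.< d → M a c · M b d ≈ M a d · M b c

    Profiled : Vector ℕ n → Set ℓ₁
    Profiled r = ∀ i → Profile i (r i)

    covered⇒1 : ∀ {i r} a b → a Fin.≤ i → i Fin.≤ b → M a b ≉ 0# → Profile i r → r ≡ 1
    covered⇒1 a b a≤i i≤b Mab≉0 (blank z)           = contradiction (z a b a≤i i≤b) Mab≉0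
    covered⇒1 a b a≤i i≤b Mab≉0 (covered _ _ _ _ _) = ≡.refl

    blank⇒0 : ∀ {i r} → Blank i → Profile i r → r ≡ 0
    blank⇒0 z (blank _)                     = ≡.refl
    blank⇒0 z (covered a b a≤i i≤b Mab≉0) = contradiction (z a b a≤i i≤b) Mab≉0

    -- Minors with a repeated row or column vanish, and exchanging rows or columns only changes the
    -- sign, so the ordered minors of `Thin` suffice.
    thin-minors : Thin → ∀ {i a b c d : Fin n} → a Fin.≤ i → b Fin.≤ i → i Fin.≤ c → i Fin.≤ d →
                  M a c · M b d ≈ M a d · M b c
    thin-minors thin {i} {a} {b} {c} {d} a≤i b≤i i≤c i≤d with Finₚ.<-cmp a b | Finₚ.<-cmp c d
    ... | tri≈ _ ≡.refl _ | _               = *-comm _ _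
    ... | _               | tri≈ _ ≡.refl _ = refl
    ... | tri< a<b _ _    | tri< c<d _ _    = thin a b c d a<b (ℕₚ.≤-trans b≤i i≤c) c<d
    ... | tri< a<b _ _    | tri> _ _ d<c    = sym (thin a b d c a<b (ℕₚ.≤-trans b≤i i≤d) d<c)
    ... | tri> _ _ b<a    | tri< c<d _ _    =
      trans (*-comm _ _) (trans (sym (thin b a c d b<a (ℕₚ.≤-trans a≤i i≤c) c<d)) (*-comm _ _))
    ... | tri> _ _ b<a    | tri> _ _ d<c    =
      trans (*-comm _ _) (trans (thin b a d c b<a (ℕₚ.≤-trans a≤i i≤d) d<c) (*-comm _ _))

    thin⇒corner-rank≤1 : Thin → ∀ i s → IndependentColumns (corner M i) s → s ≤ 1
    thin⇒corner-rank≤1 thin i = minors-zero⇒rank≤1 (corner M i) λ x y u v →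
      thin-minors thin {i} (cornerRow≤ i x) (cornerRow≤ i y) (≤cornerColumn i u) (≤cornerColumn i v)

    nonzero⇒independent : ∀ {i} a b → a Fin.≤ i → i Fin.≤ b → M a b ≉ 0# → IndependentColumns (corner M i) 1
    nonzero⇒independent {i} a b a≤i i≤b Mab≉0
      with cornerRow-surjective {i} a≤i | cornerColumn-surjective {i} i≤b
    ... | _ , ≡.refl | _ , ≡.refl = independent-one (corner M _) Mab≉0

    minor⇒independent : ∀ {i} (a b c d : Fin n) → a Fin.≤ i → b Fin.≤ i → i Fin.≤ c → i Fin.≤ d →
                        M a c · M b d ≉ M a d · M b c → IndependentColumns (corner M i) 2
    minor⇒independent {i} a b c d a≤i b≤i i≤c i≤d minor≉0
      with cornerRow-surjective {i} a≤i | cornerRow-surjective {i} b≤i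
         | cornerColumn-surjective {i} i≤c | cornerColumn-surjective {i} i≤d
    ... | _ , ≡.refl | _ , ≡.refl | _ , ≡.refl | _ , ≡.refl = independent-two (corner M _) minor≉0

    profile⇒rank : Thin → ∀ {i r} → Profile i r → HasRank (corner M i) r
    profile⇒rank thin {i} (blank z) =
      independent-none (corner M i) ,
      zero⇒rank≤0 (corner M i) λ x u → z _ _ (cornerRow≤ i x) (≤cornerColumn i u)
    profile⇒rank thin {i} (covered a b a≤i i≤b Mab≉0) =
      nonzero⇒independent a b a≤i i≤b Mab≉0 , thin⇒corner-rank≤1 thin i

    -- An independent column is not zero, and decidable equality over finitely many rows produces an
    -- actual nonzero entry.
    independent⇒covered : ∀ {i} → IndependentColumns (corner M i) 1 → Profile i 1
    independent⇒covered {i} (σ , ind)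
      with ¬∀⟶∃¬ _ _ (λ x → corner M i x (σ zero) ≟ 0#) column≉0
      where
      column≉0 : ¬ (∀ x → corner M i x (σ zero) ≈ 0#)
      column≉0 z = 1≉0 (ind (λ _ → 1#)
        (λ x → trans (+-identityʳ _) (trans (*-identityˡ _) (z x))) zero)
    ... | x , Nx≉0 = covered _ _ (cornerRow≤ i x) (≤cornerColumn i (σ zero)) Nx≉0

    rank⇒profile : Thin → ∀ {i r} → HasRank (corner M i) r → Profile i r
    rank⇒profile thin {i} {zero} (_ , maximal) = blank λ a b a≤i i≤b →
      decidable-stable (M a b ≟ 0#) λ Mab≉0 →
        contradiction (maximal 1 (nonzero⇒independent a b a≤i i≤b Mab≉0)) λ ()
    rank⇒profile thin {i} {suc zero}    (ind , _) = independent⇒covered ind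
    rank⇒profile thin {i} {suc (suc r)} (ind , _) =
      contradiction (thin⇒corner-rank≤1 thin i _ ind) λ { (s≤s ()) }

  -- Sums of ranks, and thinness from small flag rank

  sumFrom : ∀ {n} → Vector ℕ n → Fin n → ℕ
  sumFrom r zero    = sumℕ r
  sumFrom r (suc i) = sumFrom (tail r) i

  sumFrom≤sum : ∀ {n} (r : Vector ℕ n) i → sumFrom r i ≤ sumℕ r
  sumFrom≤sum r zero    = ℕₚ.≤-refl
  sumFrom≤sum r (suc i) = ℕₚ.≤-trans (sumFrom≤sum (tail r) i) (ℕₚ.m≤n+m _ (r zero))

  +-sumFrom : ∀ {n} (r : Vector ℕ n) {i j} → i Fin.< j → r i + sumFrom r j ≤ sumFrom r i
  +-sumFrom r {zero}  {suc j} _         = ℕₚ.+-monoʳ-≤ (r zero) (sumFrom≤sum (tail r) j)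
  +-sumFrom r {suc i} {suc j} (s≤s i<j) = +-sumFrom (tail r) i<j

  ≤sumFrom : ∀ {n} (r : Vector ℕ n) i → r i ≤ sumFrom r i
  ≤sumFrom r zero    = ℕₚ.m≤m+n (r zero) _
  ≤sumFrom r (suc i) = ≤sumFrom (tail r) i

  ≤sum : ∀ {n} (r : Vector ℕ n) i → r i ≤ sumℕ r
  ≤sum r i = ℕₚ.≤-trans (≤sumFrom r i) (sumFrom≤sum r i)

  -- The suffix sums from `i`, `j` and `k` are nested, so each entry is added to a suffix that
  -- starts after it.
  three-summands : ∀ {n} (r : Vector ℕ n) {i j k} → i Fin.< j → j Fin.< k →
                   r i + (r j + r k) ≤ sumℕ r
  three-summands r {i} {j} {k} i<j j<k = ℕₚ.≤-trans
    (ℕₚ.+-monoʳ-≤ (r i) (ℕₚ.≤-trans (ℕₚ.+-monoʳ-≤ (r j) (≤sumFrom r k)) (+-sumFrom r j<k)))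
    (ℕₚ.≤-trans (+-sumFrom r i<j) (sumFrom≤sum r i))

  -- A nonzero minor in rows a < b and columns c < d with b ≤ c makes the
  -- corners at a, b, d have rank at least 1, 2, 1.
  flagRank≤3⇒thin : ∀ {n} {M : Matrix n n} {t} → HasFlagRank M t → t ≤ 3 → Thin M
  flagRank≤3⇒thin {M = M} (r , rank , sum≡t) t≤3 a b c d a<b b≤c c<d =
    decidable-stable (_ ≟ _) λ minor≉0 → ℕₚ.<⇒≱ (4≤sum minor≉0) (≡.subst (_≤ 3) (≡.sym sum≡t) t≤3)
    where
    a≤b = ℕₚ.<⇒≤ a<b
    c≤d = ℕₚ.<⇒≤ c<d
    b≤d = ℕₚ.≤-trans b≤c c≤d
    b<d = ℕₚ.≤-<-trans b≤c c<d
    a≤c = ℕₚ.≤-trans a≤b b≤c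
    a≤d = ℕₚ.≤-trans a≤b b≤d
    a≤a = ℕₚ.≤-refl {toℕ a}
    d≤d = ℕₚ.≤-refl {toℕ d}

    4≤sum : M a c · M b d ≉ M a d · M b c → 4 ≤ sumℕ r
    -- The third position is `d` and not `c`, because `c` may coincide with `b`.
    4≤sum minor≉0 = ℕₚ.≤-trans (ℕₚ.+-mono-≤ 1≤ra (ℕₚ.+-mono-≤ 2≤rb 1≤rd)) (three-summands r a<b b<d)
      where
      -- Each of the two products of the minor has a factor in row `a` and a factor in column `d`.
      -- If all entries of the minor in that row or in that column vanished, both products would be
      -- zero.
      1≤ra : 1 ≤ r a
      1≤ra with M a c ≟ 0# | M a d ≟ 0#
      ... | no ac≉0  | _        = proj₂ (rank a) 1 (nonzero⇒independent M a c a≤a a≤c ac≉0)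
      ... | _        | no ad≉0  = proj₂ (rank a) 1 (nonzero⇒independent M a d a≤a a≤d ad≉0)
      ... | yes ac≈0 | yes ad≈0 = contradiction
        (trans (trans (*-congʳ ac≈0) (zeroˡ _)) (sym (trans (*-congʳ ad≈0) (zeroˡ _)))) minor≉0

      1≤rd : 1 ≤ r d
      1≤rd with M b d ≟ 0# | M a d ≟ 0#
      ... | no bd≉0  | _        = proj₂ (rank d) 1 (nonzero⇒independent M b d b≤d d≤d bd≉0)
      ... | _        | no ad≉0  = proj₂ (rank d) 1 (nonzero⇒independent M a d a≤d d≤d ad≉0)
      ... | yes bd≈0 | yes ad≈0 = contradiction
        (trans (trans (*-congˡ bd≈0) (zeroʳ _)) (sym (trans (*-congʳ ad≈0) (zeroˡ _)))) minor≉0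

      2≤rb : 2 ≤ r b
      2≤rb = proj₂ (rank b) 2 (minor⇒independent M a b c d a≤b ℕₚ.≤-refl b≤c b≤d minor≉0)

  -- Block decomposition

  minor : ∀ {m n} → Matrix (suc m) (suc n) → Matrix m n
  minor M i j = M (suc i) (suc j)

  infixr 4 _◂_
  _◂_ : ∀ {n} → Vector Carrier (suc n) → Matrix n n → Matrix (suc n) (suc n)
  (row ◂ M) zero    j       = row j
  (row ◂ M) (suc i) zero    = 0#
  (row ◂ M) (suc i) (suc j) = M i j

  infix 4 _≋_
  _≋_ : ∀ {m n} → Matrix m n → Matrix m n → Set ℓ₁
  M ≋ N = ∀ i j → M i j ≈ N i j

  ◂-upper : ∀ {n} (row : Vector Carrier (suc n)) {M : Matrix n n} →
            UpperTriangular M → UpperTriangular (row ◂ M)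
  ◂-upper row up (suc i) zero    _         = refl
  ◂-upper row up (suc i) (suc j) (s≤s j<i) = up i j j<i

  -- The constraint `a < b ≤ c` keeps column zero out of every minor, so the only new minors pair
  -- the new row with a row of `M`.
  ◂-thin : ∀ {n} {row : Vector Carrier (suc n)} {M : Matrix n n} →
           (∀ b c d → b Fin.≤ c → c Fin.< d → row (suc c) · M b d ≈ row (suc d) · M b c) →
           Thin M → Thin (row ◂ M)
  ◂-thin row-minors thin zero    (suc b) (suc c) (suc d) _ (s≤s b≤c) (s≤s c<d) = row-minors b c d b≤c c<d
  ◂-thin row-minors thin (suc a) (suc b) (suc c) (suc d) (s≤s a<b) (s≤s b≤c) (s≤s c<d) = thin a b c d a<b b≤c c<d

  ◂-decompose : ∀ {n} {M : Matrix (suc n) (suc n)} {row N} → UpperTriangular M →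
                (∀ j → row j ≈ M zero j) → N ≋ minor M → (row ◂ N) ≋ M
  ◂-decompose up row≈ N≋ zero    j       = row≈ j
  ◂-decompose up row≈ N≋ (suc i) zero    = sym (up (suc i) zero (s≤s z≤n))
  ◂-decompose up row≈ N≋ (suc i) (suc j) = N≋ i j

  minor-upper : ∀ {n} {M : Matrix (suc n) (suc n)} → UpperTriangular M → UpperTriangular (minor M)
  minor-upper up i j j<i = up (suc i) (suc j) (s≤s j<i)

  minor-thin : ∀ {n} {M : Matrix (suc n) (suc n)} → Thin M → Thin (minor M)
  minor-thin thin a b c d a<b b≤c c<d =
    thin (suc a) (suc b) (suc c) (suc d) (s≤s a<b) (s≤s b≤c) (s≤s c<d)

  module _ {n} {M : Matrix (suc n) (suc n)} {i : Fin n} (row≈0 : ∀ j → i Fin.≤ j → M zero (suc j) ≈ 0#) where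

    -- The corner of `M` at `suc i` is the corner of `minor M` at `i` with a part of row zero added
    -- on top, and that part vanishes by `row≈0`.
    minor-profile : ∀ {r} → Profile M (suc i) r → Profile (minor M) i r
    minor-profile (blank z) = blank λ a b a≤i i≤b → z (suc a) (suc b) (s≤s a≤i) (s≤s i≤b)
    minor-profile (covered zero (suc b) _ (s≤s i≤b) Mab≉0) = contradiction (row≈0 b i≤b) Mab≉0
    minor-profile (covered (suc a) (suc b) (s≤s a≤i) (s≤s i≤b) Mab≉0) = covered a b a≤i i≤b Mab≉0

    extend-profile : ∀ {r} → Profile (minor M) i r → Profile M (suc i) r
    extend-profile (blank z) = blank λ where
      zero    (suc b) _         (s≤s i≤b) → row≈0 b i≤b
      (suc a) (suc b) (s≤s a≤i) (s≤s i≤b) → z a b a≤i i≤b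
    extend-profile (covered a b a≤i i≤b Mab≉0) = covered (suc a) (suc b) (s≤s a≤i) (s≤s i≤b) Mab≉0

  -- From codes to matrices

  unit⁻¹ : Fin p → Carrier
  unit⁻¹ k = proj₁ (invertible (unit≉0 k))

  unit-unit⁻¹ : ∀ k x → unit k · (unit⁻¹ k · x) ≈ x
  unit-unit⁻¹ k x = trans (sym (*-assoc _ _ _))
    (trans (*-congʳ (proj₂ (invertible (unit≉0 k)))) (*-identityˡ x))

  -- In a thin triangle the middle diagonal entry is determined by the others.
  decode : ∀ {n t} → Code p n t → Matrix n n
  decode empty                  = []
  decode (blank w)              = 0ᵛ ◂ decode w
  decode (single x w)           = (unit x ∷ 0ᵛ) ◂ decode w
  decode (domino x a b w)       = (label a ∷ unit x ∷ 0ᵛ) ◂ (label b ∷ 0ᵛ) ◂ decode w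
  decode (triangle x a b c d w) =
    (label a ∷ label b ∷ unit x ∷ 0ᵛ) ◂ (unit⁻¹ x · (label b · label c) ∷ label c ∷ 0ᵛ) ◂
    (label d ∷ 0ᵛ) ◂ decode w

  decode-upper : ∀ {n t} (w : Code p n t) → UpperTriangular (decode w)
  decode-upper (blank w)              = ◂-upper _ (decode-upper w)
  decode-upper (single x w)           = ◂-upper _ (decode-upper w)
  decode-upper (domino x a b w)       = ◂-upper _ (◂-upper _ (decode-upper w))
  decode-upper (triangle x a b c d w) = ◂-upper _ (◂-upper _ (◂-upper _ (decode-upper w)))

  0·≈0· : ∀ x y → 0# · x ≈ 0# · y
  0·≈0· x y = trans (zeroˡ x) (sym (zeroˡ y))

  ·0≈0· : ∀ x y → x · 0# ≈ 0# · y
  ·0≈0· x y = trans (zeroʳ x) (sym (zeroˡ y))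

  -- Since `i ≤ j`, a column `j` inside the block forces row `i` into the block too. A column `k`
  -- beyond the block is then zero in both rows of the minor. If both columns are beyond the block,
  -- the upper row is zero in both.
  decode-thin : ∀ {n t} (w : Code p n t) → Thin (decode w)
  decode-thin (blank w)    = ◂-thin (λ _ _ _ _ _ → 0·≈0· _ _) (decode-thin w)
  decode-thin (single x w) = ◂-thin (λ _ _ _ _ _ → 0·≈0· _ _) (decode-thin w)
  decode-thin (domino x a b w) = ◂-thin row-minors (◂-thin (λ _ _ _ _ _ → 0·≈0· _ _) (decode-thin w))
    where
    row-minors : ∀ i j k → i Fin.≤ j → j Fin.< k →
                 (unit x ∷ 0ᵛ) j · ((label b ∷ 0ᵛ) ◂ decode w) i k ≈
                 (unit x ∷ 0ᵛ) k · ((label b ∷ 0ᵛ) ◂ decode w) i j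
    row-minors zero zero    (suc k) _ _ = ·0≈0· _ _
    row-minors i    (suc j) (suc k) _ _ = 0·≈0· _ _
  decode-thin (triangle {n} x a b c d w) =
    ◂-thin row-minors (◂-thin row-minors′ (◂-thin (λ _ _ _ _ _ → 0·≈0· _ _) (decode-thin w)))
    where
    D : Matrix (suc n) (suc n)
    D = (label d ∷ 0ᵛ) ◂ decode w

    row-minors′ : ∀ i j k → i Fin.≤ j → j Fin.< k →
                  (label c ∷ 0ᵛ) j · D i k ≈ (label c ∷ 0ᵛ) k · D i j
    row-minors′ zero zero    (suc k) _ _ = ·0≈0· _ _
    row-minors′ i    (suc j) (suc k) _ _ = 0·≈0· _ _

    E : Matrix (suc (suc n)) (suc (suc n))
    E = (unit⁻¹ x · (label b · label c) ∷ label c ∷ 0ᵛ) ◂ D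

    row-minors : ∀ i j k → i Fin.≤ j → j Fin.< k →
                 (label b ∷ unit x ∷ 0ᵛ) j · E i k ≈ (label b ∷ unit x ∷ 0ᵛ) k · E i j
    -- This is the only minor inside the triangle with `i ≤ j`. The middle diagonal entry was chosen
    -- to make it vanish.
    row-minors zero       zero          (suc zero)    _        _ = sym (unit-unit⁻¹ x _)
    row-minors zero       zero          (suc (suc k)) _        _ = ·0≈0· _ _
    row-minors zero       (suc zero)    (suc (suc k)) _        _ = ·0≈0· _ _
    row-minors (suc zero) (suc zero)    (suc (suc k)) _        _ = ·0≈0· _ _
    row-minors (suc (suc i)) (suc zero) (suc (suc k)) (s≤s ()) _
    row-minors i          (suc (suc j)) (suc (suc k)) _        _ = 0·≈0· _ _
    row-minors i          (suc j)       (suc zero)    _        (s≤s ())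

  profile : ∀ {n t} → Code p n t → Vector ℕ n
  profile empty                  = []
  profile (blank w)              = 0 ∷ profile w
  profile (single x w)           = 1 ∷ profile w
  profile (domino x a b w)       = 1 ∷ 1 ∷ profile w
  profile (triangle x a b c d w) = 1 ∷ 1 ∷ 1 ∷ profile w

  sum-profile : ∀ {n t} (w : Code p n t) → sumℕ (profile w) ≡ t
  sum-profile empty                  = ≡.refl
  sum-profile (blank w)              = sum-profile w
  sum-profile (single x w)           = ≡.cong suc (sum-profile w)
  sum-profile (domino x a b w)       = ≡.cong (2 +_) (sum-profile w)
  sum-profile (triangle x a b c d w) = ≡.cong (3 +_) (sum-profile w)

  -- The top right entry of a block lies in every corner along that block, and the rows of the block
  -- are zero in all later corners.
  decode-profile : ∀ {n t} (w : Code p n t) → Profiled (decode w) (profile w)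
  decode-profile (blank w) zero    = blank λ { zero _ _ _ → refl }
  decode-profile (blank w) (suc i) = extend-profile (λ _ _ → refl) (decode-profile w i)
  decode-profile (single x w) zero    = covered zero zero z≤n z≤n (unit≉0 x)
  decode-profile (single x w) (suc i) = extend-profile (λ _ _ → refl) (decode-profile w i)
  decode-profile (domino x a b w) zero          = covered zero (suc zero) z≤n z≤n (unit≉0 x)
  decode-profile (domino x a b w) (suc zero)    = covered zero (suc zero) z≤n (s≤s z≤n) (unit≉0 x)
  decode-profile (domino x a b w) (suc (suc i)) =
    extend-profile (λ { (suc _) _ → refl }) (extend-profile (λ _ _ → refl) (decode-profile w i))
  decode-profile (triangle x a b c d w) zero =
    covered zero (suc (suc zero)) z≤n z≤n (unit≉0 x)
  decode-profile (triangle x a b c d w) (suc zero) =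
    covered zero (suc (suc zero)) z≤n (s≤s z≤n) (unit≉0 x)
  decode-profile (triangle x a b c d w) (suc (suc zero)) =
    covered zero (suc (suc zero)) z≤n (s≤s (s≤s z≤n)) (unit≉0 x)
  decode-profile (triangle x a b c d w) (suc (suc (suc i))) =
    extend-profile (λ { (suc zero) (s≤s ()) ; (suc (suc _)) _ → refl })
      (extend-profile (λ { (suc _) _ → refl }) (extend-profile (λ _ _ → refl) (decode-profile w i)))

  decode-flagRank : ∀ {n t} (w : Code p n t) → HasFlagRank (decode w) t
  decode-flagRank w = profile w ,
    (λ i → profile⇒rank (decode w) (decode-thin w) (decode-profile w i)) , sum-profile w

  minor≋ : ∀ {m n} {M N : Matrix (suc m) (suc n)} → M ≋ N → minor M ≋ minor N
  minor≋ e i j = e (suc i) (suc j)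

  -- The column of the last nonzero entry in the first row tells the four kinds of block apart.
  -- Within a kind, each parameter can be read off from its own entry.
  decode-injective : ∀ {n t} (v w : Code p n t) → decode v ≋ decode w → v ≡ w
  decode-injective empty empty e = ≡.refl
  decode-injective (blank v) (blank w) e = ≡.cong blank (decode-injective v w (minor≋ e))
  decode-injective (single x v) (single y w) e =
    ≡.cong₂ single (unit-injective (e zero zero)) (decode-injective v w (minor≋ e))
  decode-injective (domino x a b v) (domino y a′ b′ w) e
    with unit-injective (e zero (suc zero)) | label-injective (e zero zero)
       | label-injective (e (suc zero) (suc zero)) | decode-injective v w (minor≋ (minor≋ e))
  ... | ≡.refl | ≡.refl | ≡.refl | ≡.refl = ≡.refl
  decode-injective (triangle x a b c d v) (triangle y a′ b′ c′ d′ w) e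
    with unit-injective (e zero (suc (suc zero))) | label-injective (e zero zero)
       | label-injective (e zero (suc zero)) | label-injective (e (suc zero) (suc (suc zero)))
       | label-injective (e (suc (suc zero)) (suc (suc zero)))
       | decode-injective v w (minor≋ (minor≋ (minor≋ e)))
  ... | ≡.refl | ≡.refl | ≡.refl | ≡.refl | ≡.refl | ≡.refl = ≡.refl
  decode-injective (single x _)           (blank _)              e = contradiction (e zero zero) (unit≉0 x)
  decode-injective (domino x _ _ _)       (blank _)              e = contradiction (e zero (suc zero)) (unit≉0 x)
  decode-injective (domino x _ _ _)       (single _ _)           e = contradiction (e zero (suc zero)) (unit≉0 x)
  decode-injective (triangle x _ _ _ _ _) (blank _)              e = contradiction (e zero (suc (suc zero))) (unit≉0 x)
  decode-injective (triangle x _ _ _ _ _) (single _ _)           e = contradiction (e zero (suc (suc zero))) (unit≉0 x)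
  decode-injective (triangle x _ _ _ _ _) (domino _ _ _ _)       e = contradiction (e zero (suc (suc zero))) (unit≉0 x)
  decode-injective (blank _)              (single x _)           e = contradiction (sym (e zero zero)) (unit≉0 x)
  decode-injective (blank _)              (domino x _ _ _)       e = contradiction (sym (e zero (suc zero))) (unit≉0 x)
  decode-injective (single _ _)           (domino x _ _ _)       e = contradiction (sym (e zero (suc zero))) (unit≉0 x)
  decode-injective (blank _)              (triangle x _ _ _ _ _) e = contradiction (sym (e zero (suc (suc zero)))) (unit≉0 x)
  decode-injective (single _ _)           (triangle x _ _ _ _ _) e = contradiction (sym (e zero (suc (suc zero)))) (unit≉0 x)
  decode-injective (domino _ _ _ _)       (triangle x _ _ _ _ _) e = contradiction (sym (e zero (suc (suc zero)))) (unit≉0 x)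

  -- From thin matrices to codes

  Represented : ∀ {n} → Matrix n n → ℕ → Set ℓ₁
  Represented {n} M t = Σ (Code p n t) λ w → decode w ≋ M

  ·-zero-from : ∀ {x y z w} → x ≉ 0# → x · y ≈ z · w → z ≈ 0# → y ≈ 0#
  ·-zero-from x≉0 e z≈0 = ·-zero-cancelˡ x≉0 (trans e (trans (*-congʳ z≈0) (zeroˡ _)))

  represent-blank : ∀ {n t} {M : Matrix (suc n) (suc n)} → UpperTriangular M →
                    (∀ j → M zero j ≈ 0#) → Represented (minor M) t → Represented M t
  represent-blank up row≈0 (w , e) = blank w , ◂-decompose up (sym ∘ row≈0) e

  represent-single : ∀ {n t} {M : Matrix (suc n) (suc n)} → UpperTriangular M →
                     M zero zero ≉ 0# → (∀ j → M zero (suc j) ≈ 0#) →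
                     Represented (minor M) t → Represented M (1 + t)
  represent-single up x≉0 row≈0 (w , e) with unit-surjective x≉0
  ... | k , k≈ = single k w , ◂-decompose up (λ { zero → k≈ ; (suc j) → sym (row≈0 j) }) e

  module _ {n} {M : Matrix (2 + n) (2 + n)} (up : UpperTriangular M) (thin : Thin M)
           (x≉0 : M zero (suc zero) ≉ 0#) (row≈0 : ∀ j → M zero (suc (suc j)) ≈ 0#) where

    domino-row₁≈0 : ∀ j → M (suc zero) (suc (suc j)) ≈ 0#
    domino-row₁≈0 j = ·-zero-from x≉0
      (thin zero (suc zero) (suc zero) (suc (suc j)) (s≤s z≤n) (s≤s z≤n) (s≤s (s≤s z≤n))) (row≈0 j)

    represent-domino : ∀ {t} → Represented (minor (minor M)) t → Represented M (2 + t)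
    represent-domino (w , e) with unit-surjective x≉0
    ... | k , k≈ = domino k (index (M zero zero)) (index (M (suc zero) (suc zero))) w ,
      ◂-decompose up
        (λ { zero → label-index _ ; (suc zero) → k≈ ; (suc (suc j)) → sym (row≈0 j) })
        (◂-decompose (minor-upper up)
          (λ { zero → label-index _ ; (suc j) → sym (domino-row₁≈0 j) }) e)

  module _ {n} {M : Matrix (3 + n) (3 + n)} (up : UpperTriangular M) (thin : Thin M)
           (x≉0 : M zero (suc (suc zero)) ≉ 0#) (row≈0 : ∀ j → M zero (suc (suc (suc j))) ≈ 0#) where

    triangle-row₁≈0 : ∀ j → M (suc zero) (suc (suc (suc j))) ≈ 0#
    triangle-row₁≈0 j = ·-zero-from x≉0
      (thin zero (suc zero) (suc (suc zero)) (suc (suc (suc j)))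
        (s≤s z≤n) (s≤s z≤n) (s≤s (s≤s (s≤s z≤n)))) (row≈0 j)

    triangle-row₂≈0 : ∀ j → M (suc (suc zero)) (suc (suc (suc j))) ≈ 0#
    triangle-row₂≈0 j = ·-zero-from x≉0
      (thin zero (suc (suc zero)) (suc (suc zero)) (suc (suc (suc j)))
        (s≤s z≤n) (s≤s (s≤s z≤n)) (s≤s (s≤s (s≤s z≤n)))) (row≈0 j)

    represent-triangle : ∀ {t} → Represented (minor (minor (minor M))) t → Represented M (3 + t)
    represent-triangle (w , e) with unit-surjective x≉0
    ... | k , k≈ = triangle k (index (M zero zero)) m₀₁ m₁₂ (index (M (suc (suc zero)) (suc (suc zero)))) w ,
      ◂-decompose up
        (λ { zero → label-index _ ; (suc zero) → label-index _ ; (suc (suc zero)) → k≈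
           ; (suc (suc (suc j))) → sym (row≈0 j) })
        (◂-decompose (minor-upper up)
          (λ { zero → centre ; (suc zero) → label-index _
             ; (suc (suc j)) → sym (triangle-row₁≈0 j) })
          (◂-decompose (minor-upper (minor-upper up))
            (λ { zero → label-index _ ; (suc j) → sym (triangle-row₂≈0 j) }) e))
      where
      m₀₁ m₁₂ : Fin (suc p)
      m₀₁ = index (M zero (suc zero))
      m₁₂ = index (M (suc zero) (suc (suc zero)))

      -- The vanishing minor in rows 0, 1 and columns 1, 2 determines the middle entry after
      -- division by the top right one.
      centre : unit⁻¹ k · (label m₀₁ · label m₁₂) ≈ M (suc zero) (suc zero)
      centre = ·-cancelˡ (unit≉0 k) (begin
        unit k · (unit⁻¹ k · (label m₀₁ · label m₁₂))           ≈⟨ unit-unit⁻¹ k _ ⟩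
        label m₀₁ · label m₁₂                                   ≈⟨ *-cong (label-index _) (label-index _) ⟩
        M zero (suc zero) · M (suc zero) (suc (suc zero))
          ≈⟨ thin zero (suc zero) (suc zero) (suc (suc zero)) (s≤s z≤n) (s≤s z≤n) (s≤s (s≤s z≤n)) ⟩
        M zero (suc (suc zero)) · M (suc zero) (suc zero)   ≈⟨ *-congʳ k≈ ⟨
        unit k · M (suc zero) (suc zero)                    ∎)

  -- The sum is bounded by 3 rather than fixed, so that the conditions pass to the matrix left after
  -- removing a block.
  record Admissible {n} (M : Matrix n n) (r : Vector ℕ n) : Set (c ⊔ ℓ₁) where
    field
      upper    : UpperTriangular M
      thin     : Thin M
      profiled : Profiled M r
      sum≤3    : sumℕ r ≤ 3

  open Admissible

  Encodable : ℕ → Set (c ⊔ ℓ₁)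
  Encodable n = ∀ {M : Matrix n n} {r} → Admissible M r → Represented M (sumℕ r)

  tail-sum≤3 : ∀ {n} (r : Vector ℕ (suc n)) → sumℕ r ≤ 3 → sumℕ (tail r) ≤ 3
  tail-sum≤3 r = ℕₚ.≤-trans (ℕₚ.m≤n+m _ (r zero))

  -- `encode₁`, `encode₂` and `encode₃` test the first row in columns 0, 1 and 2, with zeros known
  -- further right. A nonzero entry fixes the size of the block; a zero passes to the preceding
  -- function, and in `encode₁` gives a blank.
  encode₁ : ∀ {n} → Encodable n → {M : Matrix (1 + n) (1 + n)} {r : Vector ℕ (1 + n)} → Admissible M r →
            (∀ j → M zero (suc j) ≈ 0#) → Represented M (sumℕ r)
  encode₁ rec {M} {r} adm row≈0 = helper (M zero zero ≟ 0#)
    where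
    inner : Represented (minor M) (sumℕ (tail r))
    inner = rec record
      { upper    = minor-upper (upper adm)
      ; thin     = minor-thin (thin adm)
      ; profiled = λ i → minor-profile (λ j _ → row≈0 j) (profiled adm (suc i))
      ; sum≤3    = tail-sum≤3 r (sum≤3 adm)
      }

    represented : ∀ {k} → r zero ≡ k → Represented M (k + sumℕ (tail r)) → Represented M (sumℕ r)
    represented r₀≡k = ≡.subst (λ k → Represented M (k + sumℕ (tail r))) (≡.sym r₀≡k)

    helper : Dec (M zero zero ≈ 0#) → Represented M (sumℕ r)
    helper (yes x≈0) = represented
      (blank⇒0 M (λ { zero b _ _ → row₀≈0 b ; (suc _) _ () _ }) (profiled adm zero))
      (represent-blank (upper adm) row₀≈0 inner)
      where
      row₀≈0 : ∀ j → M zero j ≈ 0#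
      row₀≈0 zero    = x≈0
      row₀≈0 (suc j) = row≈0 j
    helper (no x≉0) = represented
      (covered⇒1 M zero zero z≤n z≤n x≉0 (profiled adm zero))
      (represent-single (upper adm) x≉0 row≈0 inner)

  encode₂ : ∀ {n} → Encodable n → Encodable (1 + n) →
            {M : Matrix (2 + n) (2 + n)} {r : Vector ℕ (2 + n)} → Admissible M r →
            (∀ j → M zero (suc (suc j)) ≈ 0#) → Represented M (sumℕ r)
  encode₂ rec₀ rec₁ {M} {r} adm row≈0 = helper (M zero (suc zero) ≟ 0#)
    where
    helper : Dec (M zero (suc zero) ≈ 0#) → Represented M (sumℕ r)
    helper (yes x≈0) = encode₁ rec₁ adm λ { zero → x≈0 ; (suc j) → row≈0 j }
    helper (no x≉0)  = ≡.subst₂ (λ k l → Represented M (k + (l + sumℕ (tail (tail r)))))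
      (≡.sym (covered⇒1 M zero (suc zero) z≤n z≤n x≉0 (profiled adm zero)))
      (≡.sym (covered⇒1 M zero (suc zero) z≤n (s≤s z≤n) x≉0 (profiled adm (suc zero))))
      (represent-domino (upper adm) (thin adm) x≉0 row≈0 (rec₀ record
        { upper    = minor-upper (minor-upper (upper adm))
        ; thin     = minor-thin (minor-thin (thin adm))
        ; profiled = λ i →
            minor-profile (λ j _ → domino-row₁≈0 (upper adm) (thin adm) x≉0 row≈0 j)
              (minor-profile (λ { (suc j) _ → row≈0 j }) (profiled adm (suc (suc i))))
        ; sum≤3    = tail-sum≤3 (tail r) (tail-sum≤3 r (sum≤3 adm))
        }))

  encode₃ : ∀ {n} → Encodable n → Encodable (1 + n) → Encodable (2 + n) → Encodable (3 + n)
  encode₃ rec₀ rec₁ rec₂ {M} {r} adm = helper (M zero (suc (suc zero)) ≟ 0#)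
    where
    -- A nonzero entry of row zero in column `3 + j` lies in the four corners at 0, 1, 2 and
    -- `3 + j`, which would make the sum at least 4.
    row≈0 : ∀ j → M zero (suc (suc (suc j))) ≈ 0#
    row≈0 j = decidable-stable (_ ≟ 0#) λ x≉0 →
      let 1≤r : ∀ i → i Fin.≤ suc (suc (suc j)) → 1 ≤ r i
          1≤r i i≤j = ℕₚ.≤-reflexive (≡.sym (covered⇒1 M zero _ z≤n i≤j x≉0 (profiled adm i)))
      in ℕₚ.<⇒≱
        (ℕₚ.+-mono-≤ (1≤r zero z≤n) (ℕₚ.+-mono-≤ (1≤r (suc zero) (s≤s z≤n))
          (ℕₚ.+-mono-≤ (1≤r (suc (suc zero)) (s≤s (s≤s z≤n)))
            (ℕₚ.≤-trans (1≤r (suc (suc (suc j))) ℕₚ.≤-refl) (≤sum (tail (tail (tail r))) j)))))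
        (sum≤3 adm)

    helper : Dec (M zero (suc (suc zero)) ≈ 0#) → Represented M (sumℕ r)
    helper (yes x≈0) = encode₂ rec₁ rec₂ adm λ { zero → x≈0 ; (suc j) → row≈0 j }
    helper (no x≉0)  = represented
      (represent-triangle (upper adm) (thin adm) x≉0 row≈0 (rec₀ record
        { upper    = minor-upper (minor-upper (minor-upper (upper adm)))
        ; thin     = minor-thin (minor-thin (minor-thin (thin adm)))
        ; profiled = λ i →
            minor-profile (λ j _ → triangle-row₂≈0 (upper adm) (thin adm) x≉0 row≈0 j)
              (minor-profile
                (λ { (suc j) _ → triangle-row₁≈0 (upper adm) (thin adm) x≉0 row≈0 j })
                (minor-profile (λ { (suc zero) (s≤s ()) ; (suc (suc j)) _ → row≈0 j })
                  (profiled adm (suc (suc (suc i))))))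
        ; sum≤3    = tail-sum≤3 (tail (tail r)) (tail-sum≤3 (tail r) (tail-sum≤3 r (sum≤3 adm)))
        }))
      where
      represented : Represented M (3 + sumℕ (tail (tail (tail r)))) → Represented M (sumℕ r)
      represented = ≡.subst (Represented M) (≡.sym (≡.cong₂ _+_
        (covered⇒1 M zero _ z≤n z≤n x≉0 (profiled adm zero)) (≡.cong₂ _+_
        (covered⇒1 M zero _ z≤n (s≤s z≤n) x≉0 (profiled adm (suc zero))) (≡.cong (_+ sumℕ (tail (tail (tail r))))
        (covered⇒1 M zero _ z≤n (s≤s (s≤s z≤n)) x≉0 (profiled adm (suc (suc zero))))))))

  encode : ∀ n → Encodable n
  encode zero                = λ _ → empty , λ ()
  -- For sizes one and two there are no columns further right, so the vanishing condition is
  -- vacuous.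
  encode (suc zero)          = λ adm → encode₁ (encode zero) adm λ ()
  encode (suc (suc zero))    = λ adm → encode₂ (encode zero) (encode 1) adm λ ()
  encode (suc (suc (suc n))) = encode₃ (encode n) (encode (suc n)) (encode (suc (suc n)))

  -- The bijection between spheres and codes

  flagRank⇒code : ∀ {n t} {M : Matrix n n} → UpperTriangular M → HasFlagRank M t → t ≤ 3 → Represented M t
  flagRank⇒code {n} {t} {M} up fr@(r , rank , sum≡t) t≤3 = ≡.subst (Represented M) sum≡t (encode n record
    { upper    = up
    ; thin     = thinM
    ; profiled = λ i → rank⇒profile M thinM (rank i)
    ; sum≤3    = ≡.subst (_≤ 3) (≡.sym sum≡t) t≤3
    })
    where
    thinM : Thin M
    thinM = flagRank≤3⇒thin fr t≤3

  -- The code is built using the rank data, which equality in the sphere ignores. It still depends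
  -- only on the matrix, because `decode` is injective and returns that matrix.
  sphere↔code : ∀ n {t} → t ≤ 3 → Inverse (sphere n t) (≡.setoid (Code p n t))
  sphere↔code n {t} t≤3 = record
    { to        = λ (M , up , fr) → proj₁ (flagRank⇒code up fr t≤3)
    ; from      = λ w → decode w , decode-upper w , decode-flagRank w
    ; to-cong   = λ {(M , up , fr)} {(M′ , up′ , fr′)} M≋M′ → decode-injective _ _ λ i j →
        trans (proj₂ (flagRank⇒code up fr t≤3) i j)
          (trans (M≋M′ i j) (sym (proj₂ (flagRank⇒code up′ fr′ t≤3) i j)))
    ; from-cong = λ { ≡.refl i j → refl }
    ; inverse   =
        (λ {w} {(M , up , fr)} M≋ → decode-injective _ w λ i j →
          trans (proj₂ (flagRank⇒code up fr t≤3) i j) (M≋ i j)) ,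
        (λ { {(M , up , fr)} ≡.refl i j → proj₂ (flagRank⇒code up fr t≤3) i j })
    }

proposition3p3 : ∀ {c ℓ₁ ℓ₂} (q : ℕ) → IsPrimePower q →
    (F : HeytingField c ℓ₁ ℓ₂) → FlagRank.HasOrder F q →
    (n : ℕ) → 3 ≤ n →
    HasCardinality (FlagRank.sphere F n 3)
    ((n ∸ 2) * q ^ 4 * (q ∸ 1)
    + (n ∸ 1) * (n ∸ 2) * q ^ 2 * (q ∸ 1) ^ 2
    + (n C 3) * (q ∸ 1) ^ 3)
-- A field has the element `0#`, so its order is not zero.
proposition3p3 zero    _ F order n _ = contradiction (Inverse.to order (HeytingField.0# F)) λ ()
-- With order `suc p` and size `2 + n` the truncated differences compute to `p`, `n` and `1 + n`, as
-- in `codeCount-3`.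
proposition3p3 (suc p) _ F order (suc (suc n)) _ =
  ≡.subst (HasCardinality (FlagRank.sphere F (2 + n) 3)) (Counting.codeCount-3 p n)
    (inverse (Spheres.sphere↔code F p order (2 + n) ℕₚ.≤-refl) (Counting.code↔Fin p (2 + n) 3))
proposition3p3 (suc p) _ F order (suc zero) (s≤s ())
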